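{- Let $S$ be an infinite set, $\mathcal{F}\subseteq 2^S$ nontrivial and closed under finite unions, and let $(C,\mathbf{A})$ be a conditional classification problem with $\mathbf{A}=(A_1,\dots,A_k)$. Then the following are equivalent: (i) $\mathbf{A}\in\mathit{ccore}_k(C,\mathcal{F})$; (ii) for all $1\le i\le k$: $A_i\notin\mathit{cclass}_1(C,\mathcal{F})$ and $A_i\in\mathit{ccohesive}(S\setminus C,\mathcal{F})$.
   Context: $\mathcal{F}$ is nontrivial if $\emptyset,S\in\mathcal{F}$ and for all $Q\in\mathcal{F}$ and finite $E\subseteq S$ both $Q\cup E\in\mathcal{F}$ and $Q\setminus E\in\mathcal{F}$. A classification problem is a vector $(A_1,\dots,A_k)$, $k\ge1$, of pairwise disjoint infinite subsets of $S$, of length $k$. A conditional classification problem is a pair $(C,\mathbf{A})$ with $C\subseteq S$, $\mathbf{A}$ a classification problem and $C$ disjoint from all components of $\mathbf{A}$. For vectors $\mathbf{B}=(B_1,\dots,B_m)$, $\mathbf{Q}=(Q_1,\dots,Q_k)$, $\mathbf{B}\le\mathbf{Q}$ means $1\le m\le k$ and there is an injective $\sigma:\{1,\dots,m\}\to\{1,\dots,k\}$ with $B_i\subseteq Q_{\sigma(i)}$. An $\mathcal{F}$-partition is a vector of pairwise disjoint members of $\mathcal{F}$ whose union is $S$. $\mathit{cclass}_k(C,\mathcal{F})$ is the set of classification problems $\mathbf{A}$ of length $k$ such that $(C,\mathbf{A})$ is a conditional classification problem and there is an $\mathcal{F}$-partition $(Q_0,Q_1,\dots,Q_k)$ with $C\subseteq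 Q_0$ and $\mathbf{A}\le(Q_1,\dots,Q_k)$ (a single set $A$ is identified with the vector $(A)$). $\mathit{ccore}_k(C,\mathcal{F})$ is the set of classification problems $\mathbf{A}$ of length $k$ with $(C,\mathbf{A})$ a conditional classification problem such that every classification problem $\mathbf{A}'\le\mathbf{A}$ (any length $\ge1$) satisfies $\mathbf{A}'\notin\mathit{cclass}_{|\mathbf{A}'|}(C,\mathcal{F})$. For $D\subseteq S$, $A\in\mathit{ccohesive}(D,\mathcal{F})$ iff $A$ is infinite and for every $Q\subseteq D$ with $Q\in\mathcal{F}$ and $S\setminus Q\in\mathcal{F}$, either $A\cap Q$ or $A\setminus Q$ is finite. -}

module Defs where

open import Data.Fin.Base using (Fin)
import Data.List.Membership.Propositional as List
open import Data.Nat.Base using (ℕ; suc; _≤_)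
open import Data.Product.Base using (_×_; ∃-syntax)
open import Data.Sum.Base using (_⊎_)
open import Data.Vec.Functional using (Vector; head; tail)
open import Function.Definitions using (Injective)
open import Level using (Level; _⊔_) renaming (suc to lsuc)
open import Relation.Binary.PropositionalEquality.Core using (_≡_; _≢_)
open import Relation.Nullary.Negation.Core using (¬_)
open import Relation.Unary using (Pred; _∈_; _∉_; _⊆_; _≐_; _∪_; _∩_; _∖_; _⊥_; ∁; ⋃)
open import Relation.Unary.Polymorphic using (∅; U)

private
  variable
    s ℓ f : Level
    k m : ℕ

-- Subsets of S are predicates, compared by _≐_; a family of subsets is a
-- predicate on predicates, which has to respect _≐_ to denote a subset of 2^S.

Finite : {S : Set s} → Pred S ℓ → Set (s ⊔ ℓ)
Finite P = ∃[ xs ] P ≐ (List._∈ xs)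

Infinite : {S : Set s} → Pred S ℓ → Set (s ⊔ ℓ)
Infinite P = ¬ Finite P

record Nontrivial {S : Set s} (𝓕 : Pred (Pred S ℓ) f) : Set (s ⊔ lsuc ℓ ⊔ f) where
  field
    ∅∈𝓕      : ∅ ∈ 𝓕
    U∈𝓕      : U ∈ 𝓕
    ∪-finite : ∀ (Q E : Pred S ℓ) → Q ∈ 𝓕 → Finite E → (Q ∪ E) ∈ 𝓕
    ∖-finite : ∀ (Q E : Pred S ℓ) → Q ∈ 𝓕 → Finite E → (Q ∖ E) ∈ 𝓕

ClosedUnderFiniteUnions : {S : Set s} → Pred (Pred S ℓ) f → Set (s ⊔ lsuc ℓ ⊔ f)
ClosedUnderFiniteUnions {ℓ = ℓ} {S = S} 𝓕 =
  ∀ n (Q : Vector (Pred S ℓ) n) → (∀ i → Q i ∈ 𝓕) → ⋃ (Fin n) Q ∈ 𝓕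

PairwiseDisjoint : {S : Set s} → Vector (Pred S ℓ) k → Set (s ⊔ ℓ)
PairwiseDisjoint A = ∀ i j → i ≢ j → A i ⊥ A j

record IsClassificationProblem {S : Set s} {k : ℕ} (A : Vector (Pred S ℓ) k) : Set (s ⊔ ℓ) where
  field
    nonempty : 1 ≤ k
    disjoint : PairwiseDisjoint A
    infinite : ∀ i → Infinite (A i)

record IsConditionalClassificationProblem {S : Set s} {k : ℕ}
       (C : Pred S ℓ) (A : Vector (Pred S ℓ) k) : Set (s ⊔ ℓ) where
  field
    isClassificationProblem : IsClassificationProblem A
    C-disjoint              : ∀ i → C ⊥ A i

infix 4 _≼_

_≼_ : {S : Set s} → Vector (Pred S ℓ) m → Vector (Pred S ℓ) k → Set (s ⊔ ℓ)
_≼_ {m = m} {k = k} B Q =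
  1 ≤ m × m ≤ k ×
  ∃[ σ ] Injective {A = Fin m} {B = Fin k} _≡_ _≡_ σ × (∀ i → B i ⊆ Q (σ i))

record IsPartition {S : Set s} (𝓕 : Pred (Pred S ℓ) f) {k : ℕ}
       (Q : Vector (Pred S ℓ) k) : Set (s ⊔ ℓ ⊔ f) where
  field
    member   : ∀ i → Q i ∈ 𝓕
    disjoint : PairwiseDisjoint Q
    covers   : ⋃ (Fin k) Q ≐ U {ℓ = ℓ}

cclass : {S : Set s} (k : ℕ) → Pred S ℓ → Pred (Pred S ℓ) f →
         Pred (Vector (Pred S ℓ) k) (s ⊔ lsuc ℓ ⊔ f)
cclass k C 𝓕 A =
  IsConditionalClassificationProblem C A ×
  (∃[ Q ] IsPartition 𝓕 {suc k} Q × C ⊆ head Q × A ≼ tail Q)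

ccore : {S : Set s} (k : ℕ) → Pred S ℓ → Pred (Pred S ℓ) f →
        Pred (Vector (Pred S ℓ) k) (s ⊔ lsuc ℓ ⊔ f)
ccore {ℓ = ℓ} {S = S} k C 𝓕 A =
  IsConditionalClassificationProblem C A ×
  (∀ m (A′ : Vector (Pred S ℓ) m) → IsClassificationProblem A′ → A′ ≼ A → A′ ∉ cclass m C 𝓕)

ccohesive : {S : Set s} → Pred S ℓ → Pred (Pred S ℓ) f → Pred (Pred S ℓ) (s ⊔ lsuc ℓ ⊔ f)
ccohesive D 𝓕 A =
  Infinite A ×
  (∀ Q → Q ⊆ D → Q ∈ 𝓕 → ∁ Q ∈ 𝓕 → Finite (A ∩ Q) ⊎ Finite (A ∖ Q))

{-# OPTIONS --safe #-}

-- If Q ∈ 𝓕 has its complement in 𝓕 and misses C, then (∁ Q , Q) is a partition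
-- showing that every infinite subset of Q is in cclass₁.  Hence a core component
-- meets each such Q in a finite set, which gives cohesiveness.  Conversely, let a
-- problem below A be classified by a partition, and let Q be a part holding an
-- infinite subset of some Aᵢ.  Its complement is the union of the other parts, so
-- by cohesiveness Aᵢ ∖ Q is finite; moving it into Q puts Aᵢ itself in cclass₁.

module Submission where

open import Defs
open import Axiom.ExcludedMiddle using (ExcludedMiddle)
open import Data.Fin.Base using (Fin; zero; suc; punchIn; punchOut)
open import Data.Fin.Properties using (_≟_; punchIn-punchOut; punchInᵢ≢i)
open import Data.List.Base using (filter)
open import Data.List.Membership.Propositional.Properties using (∈-filter⁺; ∈-filter⁻)
open import Data.Nat.Base using (ℕ; suc; _≤_; z≤n; s≤s)
open import Data.Product.Base using (_×_; _,_; proj₁; proj₂)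
open import Data.Sum.Base using (inj₁; inj₂; [_,_])
open import Data.Vec.Functional using (Vector; []; _∷_)
open import Function.Base using (_∘_)
open import Function.Bundles using (_⇔_; mk⇔)
open import Level using (Level; _⊔_; Lift; lift; lower)
open import Relation.Binary.Definitions using (_Respects_)
open import Relation.Binary.PropositionalEquality.Core using (refl; sym; subst)
open import Relation.Nullary.Decidable.Core using (yes; no; map′; decidable-stable)
open import Relation.Nullary.Negation.Core using (contradiction)
open import Relation.Unary using (Pred; Decidable; _∈_; _∉_; _⊆_; _≐_; _∪_; _∩_; _∖_; ∁; ⋃)
open import Relation.Unary.Polymorphic using (U)

private
  variable
    s ℓ f : Level
    S : Set s
    k : ℕ

Fin⇒1≤ : Fin k → 1 ≤ k
Fin⇒1≤ {k = suc _} _ = s≤s z≤n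

[-]-≼ : {B : Pred S ℓ} (A : Vector (Pred S ℓ) k) → ∀ i → B ⊆ A i → (B ∷ []) ≼ A
[-]-≼ _ i B⊆Aᵢ =
  s≤s z≤n , Fin⇒1≤ i , (λ _ → i) ,
  (λ { {zero} {zero} _ → refl }) , λ { zero → B⊆Aᵢ }

[-]-isClassificationProblem : {B : Pred S ℓ} → Infinite B → IsClassificationProblem (B ∷ [])
[-]-isClassificationProblem inf = record
  { nonempty = s≤s z≤n
  ; disjoint = λ { zero zero 0≢0 → contradiction refl 0≢0 }
  ; infinite = λ { zero → inf }
  }

-- A finite set has to be exactly the members of a list, so the list for `Q` is filtered by `P`;
-- this is why `P` must be decidable.
Finite-⊆ : {P Q : Pred S ℓ} → Decidable P → P ⊆ Q → Finite Q → Finite P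
Finite-⊆ P? P⊆Q (xs , Q⊆xs , _) =
  filter P? xs , (λ Px → ∈-filter⁺ P? (Q⊆xs (P⊆Q Px)) Px) ,
  λ x∈ → proj₂ (∈-filter⁻ P? {xs = xs} x∈)

module _ {𝓕 : Pred (Pred S ℓ) f} (resp : 𝓕 Respects _≐_) where

  ∁-part∈𝓕 : ClosedUnderFiniteUnions 𝓕 → {Q : Vector (Pred S ℓ) (suc k)} →
             IsPartition 𝓕 Q → ∀ j → ∁ (Q j) ∈ 𝓕
  ∁-part∈𝓕 {k = k} ∪-closed {Q = Q} part j =
    resp (others⊆ , ⊆others) (∪-closed k others (member ∘ punchIn j))
    where
    open IsPartition part
    others : Vector (Pred S ℓ) k
    others = Q ∘ punchIn j
    others⊆ : ⋃ (Fin k) others ⊆ ∁ (Q j)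
    others⊆ (i , x∈Qᵢ) x∈Qⱼ = disjoint (punchIn j i) j (punchInᵢ≢i j i) (x∈Qᵢ , x∈Qⱼ)
    ⊆others : ∁ (Q j) ⊆ ⋃ (Fin k) others
    ⊆others {x} x∉Qⱼ with proj₂ covers {x} _
    ... | i , x∈Qᵢ with j ≟ i
    ...   | yes refl = contradiction x∈Qᵢ x∉Qⱼ
    ...   | no  j≢i  = punchOut j≢i , subst (λ l → x ∈ Q l) (sym (punchIn-punchOut j≢i)) x∈Qᵢ

  -- By De Morgan, adding `E` to `Q` amounts to removing `E` from `∁ Q`, and nontriviality permits
  -- removing finite sets.
  ∪-finite⇒∁∈𝓕 : Nontrivial 𝓕 → {Q E : Pred S ℓ} → ∁ Q ∈ 𝓕 → Finite E → ∁ (Q ∪ E) ∈ 𝓕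
  ∪-finite⇒∁∈𝓕 nt {Q} {E} ∁Q∈𝓕 E-fin =
    resp ((λ (x∉Q , x∉E) → [ x∉Q , x∉E ]) , λ x∉ → x∉ ∘ inj₁ , x∉ ∘ inj₂)
         (Nontrivial.∖-finite nt (∁ Q) E ∁Q∈𝓕 E-fin)

module _ (dec : (P : Pred S ℓ) → Decidable P) {𝓕 : Pred (Pred S ℓ) f} where

  -- `∁ Q` comes first because part `zero` is the one that has to contain `C` in `cclass`.
  complementaryPartition : {Q : Pred S ℓ} → Q ∈ 𝓕 → ∁ Q ∈ 𝓕 → IsPartition 𝓕 (∁ Q ∷ Q ∷ [])
  complementaryPartition {Q = Q} Q∈𝓕 ∁Q∈𝓕 = record
    { member   = λ { zero → ∁Q∈𝓕 ; (suc zero) → Q∈𝓕 }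
    ; disjoint = λ
      { zero       zero       i≢i _           → i≢i refl
      ; zero       (suc zero) _   (x∉Q , x∈Q) → x∉Q x∈Q
      ; (suc zero) zero       _   (x∈Q , x∉Q) → x∉Q x∈Q
      ; (suc zero) (suc zero) i≢i _           → i≢i refl
      }
    ; covers   = (λ _ → _) , λ {x} _ → covers x
    }
    where
    covers : ∀ x → x ∈ ⋃ (Fin 2) (∁ Q ∷ Q ∷ [])
    covers x with dec Q x
    ... | yes x∈Q = suc zero , x∈Q
    ... | no  x∉Q = zero , x∉Q

  ⊆-part⇒cclass₁ : {B C Q : Pred S ℓ} → Infinite B → B ⊆ Q → Q ⊆ ∁ C →
                   Q ∈ 𝓕 → ∁ Q ∈ 𝓕 → (B ∷ []) ∈ cclass 1 C 𝓕
  ⊆-part⇒cclass₁ {Q = Q} inf B⊆Q Q⊆∁C Q∈𝓕 ∁Q∈𝓕 =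
    record
      { isClassificationProblem = [-]-isClassificationProblem inf
      ; C-disjoint = λ { zero (x∈C , x∈B) → Q⊆∁C (B⊆Q x∈B) x∈C }
      } ,
    (∁ Q ∷ Q ∷ []) , complementaryPartition Q∈𝓕 ∁Q∈𝓕 ,
    (λ x∈C x∈Q → Q⊆∁C x∈Q x∈C) , [-]-≼ (Q ∷ []) zero B⊆Q

  -- The enlarged part still misses `C` because `B` does, and both it and its complement stay in `𝓕`
  -- since they change by a finite set only.
  almost-⊆-part⇒cclass₁ : 𝓕 Respects _≐_ → Nontrivial 𝓕 → {B C Q : Pred S ℓ} →
                          Infinite B → B ⊆ ∁ C → Q ⊆ ∁ C →
                          Q ∈ 𝓕 → ∁ Q ∈ 𝓕 → Finite (B ∖ Q) → (B ∷ []) ∈ cclass 1 C 𝓕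
  almost-⊆-part⇒cclass₁ resp nt {B} {C} {Q} inf B⊆∁C Q⊆∁C Q∈𝓕 ∁Q∈𝓕 fin =
    ⊆-part⇒cclass₁ inf B⊆Q∪ [ Q⊆∁C , B⊆∁C ∘ proj₁ ]
      (Nontrivial.∪-finite nt Q (B ∖ Q) Q∈𝓕 fin) (∪-finite⇒∁∈𝓕 resp nt ∁Q∈𝓕 fin)
    where
    B⊆Q∪ : B ⊆ Q ∪ (B ∖ Q)
    B⊆Q∪ {x} x∈B with dec Q x
    ... | yes x∈Q = inj₁ x∈Q
    ... | no  x∉Q = inj₂ (x∈B , x∉Q)

theorem4p4 : ∀ {s ℓ f : Level} → ExcludedMiddle (s ⊔ ℓ) →
  (S : Set s) → Infinite (U {A = S} {ℓ = ℓ}) →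
  (𝓕 : Pred (Pred S ℓ) f) → 𝓕 Respects _≐_ →
  Nontrivial 𝓕 → ClosedUnderFiniteUnions 𝓕 →
  (k : ℕ) (C : Pred S ℓ) (A : Vector (Pred S ℓ) k) →
  IsConditionalClassificationProblem C A →
  (A ∈ ccore k C 𝓕) ⇔
  (∀ i → ((A i ∷ []) ∉ cclass 1 C 𝓕) × (A i ∈ ccohesive (∁ C) 𝓕))
theorem4p4 {s} {ℓ} {f} em S _ 𝓕 resp nt ∪-closed k C A ccp = mk⇔ core⇒cohesive cohesive⇒core
  where
  open IsConditionalClassificationProblem ccp
  open IsClassificationProblem isClassificationProblem

  dec : (P : Pred S ℓ) → Decidable P
  -- Excluded middle is given at the level of `Finite`, so membership is lifted from `ℓ` to `s ⊔ ℓ`.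
  dec P x = map′ lower lift (em {Lift s (P x)})

  core⇒cohesive : A ∈ ccore k C 𝓕 →
                  ∀ i → ((A i ∷ []) ∉ cclass 1 C 𝓕) × (A i ∈ ccohesive (∁ C) 𝓕)
  core⇒cohesive (_ , core) i =
    core 1 (A i ∷ []) ([-]-isClassificationProblem (infinite i)) ([-]-≼ A i (λ x∈ → x∈)) ,
    infinite i ,
    -- Always the first alternative: an infinite `A i ∩ Q` would be a classified problem of length
    -- one below `A`.
    λ Q Q⊆∁C Q∈𝓕 ∁Q∈𝓕 → inj₁ (decidable-stable em λ inf →
      core 1 (A i ∩ Q ∷ []) ([-]-isClassificationProblem inf) ([-]-≼ A i proj₁)
        (⊆-part⇒cclass₁ dec inf proj₂ Q⊆∁C Q∈𝓕 ∁Q∈𝓕))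

  cohesive⇒core : (∀ i → ((A i ∷ []) ∉ cclass 1 C 𝓕) × (A i ∈ ccohesive (∁ C) 𝓕)) →
                  A ∈ ccore k C 𝓕
  cohesive⇒core hyp = ccp , notClassified
    where
    notClassified : ∀ m (A′ : Vector (Pred S ℓ) m) → IsClassificationProblem A′ →
                    A′ ≼ A → A′ ∉ cclass m C 𝓕
    -- The first component of `A′` suffices: it is an infinite set inside both `A i` and `Q j`,
    -- which rules out one alternative of cohesiveness, while the other contradicts `A∉cclass₁`.
    notClassified (suc m) A′ cp′ (_ , _ , σ , _ , A′⊆A) (_ , Q , part , C⊆Q₀ , _ , _ , τ , _ , A′⊆Q) =
      [ A∩Q-infinite , A∉cclass₁ ∘ almost-⊆-part⇒cclass₁ dec resp nt (infinite i)
                         (λ x∈A x∈C → C-disjoint i (x∈C , x∈A)) Q⊆∁C Q∈𝓕 ∁Q∈𝓕 ]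
      (proj₂ A-cohesive (Q j) Q⊆∁C Q∈𝓕 ∁Q∈𝓕)
      where
      i = σ zero
      -- The shift by `suc` skips part `zero`, which holds `C`; hence `Q j` misses `C` by
      -- disjointness.
      j = suc (τ zero)
      A∉cclass₁ = proj₁ (hyp i)
      A-cohesive = proj₂ (hyp i)
      Q∈𝓕 = IsPartition.member part j
      ∁Q∈𝓕 = ∁-part∈𝓕 resp ∪-closed part j
      Q⊆∁C : Q j ⊆ ∁ C
      Q⊆∁C x∈Q x∈C = IsPartition.disjoint part zero j (λ ()) (C⊆Q₀ x∈C , x∈Q)
      A∩Q-infinite : Infinite (A i ∩ Q j)
      A∩Q-infinite = IsClassificationProblem.infinite cp′ zero ∘
        Finite-⊆ (dec (A′ zero)) (λ x∈ → A′⊆A zero x∈ , A′⊆Q zero x∈)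
    -- The relation `≼` demands length at least one on its left.
    notClassified 0 _ _ (() , _)
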